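{- For every integer $m\ge 2$, $$N_1(m)=\frac{R(m)+1}{2}.$$
   Context: $\pi(x)$ denotes the number of primes $p\le x$. For a positive integer $m$, $R(m)$ (the $m$-th Ramanujan prime) is the smallest positive integer such that for all integers $x\ge R(m)$ one has $\pi(x)-\pi(x/2)\ge m$. For a positive integer $m$, $N_1(m)$ is the smallest positive integer such that for every integer $n\ge N_1(m)$ the open interval $(n,2n)$ contains at least $m$ primes. -}

module Defs where

open import Data.List using (length; filter; upTo)
open import Data.Nat using (ℕ; suc; _*_; _∸_; _≤_; _<_; _<?_)
open import Data.Nat.DivMod using (_/_)
open import Data.Nat.Primality using (prime?)
open import Data.Product using (_×_)

π : ℕ → ℕ
π x = length (filter prime? (upTo (suc x)))

-- The number of primes p with a < p < b; upTo b lists 0, …, b ∸ 1.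
primesBetween : ℕ → ℕ → ℕ
primesBetween a b = length (filter (a <?_) (filter prime? (upTo b)))

IsLeastPositive : (ℕ → Set) → ℕ → Set
IsLeastPositive P k = 0 < k × P k × (∀ j → 0 < j → P j → k ≤ j)

-- "R = R(m)". A prime is at most x/2 exactly when it is at most ⌊x/2⌋, so the
-- floor division gives π(x/2); and π(⌊x/2⌋) ≤ π(x), so _∸_ never truncates.
-- R(m) and N₁(m) are given by their graphs: being least determines the value
-- uniquely, while existence of a value is a theorem about primes.
IsRamanujanPrime : ℕ → ℕ → Set
IsRamanujanPrime m =
  IsLeastPositive λ R → ∀ x → R ≤ x → m ≤ π x ∸ π (x / 2)

-- "N = N₁(m)".
IsN₁ : ℕ → ℕ → Set
IsN₁ m =
  IsLeastPositive λ N → ∀ n → N ≤ n → m ≤ primesBetween n (2 * n)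

{-# OPTIONS --safe #-}

-- Put f x = π x ∸ π (x / 2).  By minimality f (R ∸ 1) < m ≤ f R, and f can only
-- increase at a prime, so R is an odd prime, R = 1 + 2 k.  As 2 n is composite
-- for n ≥ 2, the number of primes in (n , 2n) is exactly f (2 n).  It is at least
-- m for all n ≥ k + 1, since then 2 n ≥ R, but not for n = k; so N = k + 1.

module Submission where

open import Data.List using (List; _++_; [_]; length; filter; upTo)
open import Data.List.Properties
  using (upTo-∷ʳ; filter-++; filter-accept; filter-reject; length-++; ++-identityʳ)
open import Data.Nat using (ℕ; zero; suc; _+_; _*_; _∸_; _≤_; _<_; _<?_; z≤n; s≤s)
open import Data.Nat.DivMod using (_/_; /-monoˡ-≤; m*n/n≡m)
open import Data.Nat.Divisibility using (m∣m*n)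
open import Data.Nat.Primality using (Prime; prime?; prime; composite)
open import Data.Nat.Properties
open import Data.Product using (_×_; _,_; ∃-syntax)
open import Data.Sum using (_⊎_; inj₁; inj₂)
open import Relation.Binary.PropositionalEquality
  using (_≡_; refl; sym; trans; cong; cong₂; subst; module ≡-Reasoning)
open import Relation.Nullary using (¬_; yes; no; contradiction)
open import Defs

-- By definition `π x` is the length of `primesBelow (suc x)`, and `primesBetween a b` filters
-- `primesBelow b`, so one recursion on this list serves both counts.
primesBelow : ℕ → List ℕ
primesBelow x = filter prime? (upTo x)

primesBelow-suc : ∀ x → primesBelow (suc x) ≡ primesBelow x ++ filter prime? [ x ]
primesBelow-suc x = trans (cong (filter prime?) (sym (upTo-∷ʳ x))) (filter-++ prime? (upTo x) [ x ])

primesBelow-suc-prime : ∀ {x} → Prime x → primesBelow (suc x) ≡ primesBelow x ++ [ x ]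
primesBelow-suc-prime {x} p =
  trans (primesBelow-suc x) (cong (primesBelow x ++_) (filter-accept prime? p))

primesBelow-suc-¬prime : ∀ {x} → ¬ Prime x → primesBelow (suc x) ≡ primesBelow x
primesBelow-suc-¬prime {x} ¬p =
  trans (primesBelow-suc x)
    (trans (cong (primesBelow x ++_) (filter-reject prime? ¬p)) (++-identityʳ _))

π-suc-prime : ∀ {x} → Prime (suc x) → π (suc x) ≡ suc (π x)
π-suc-prime {x} p =
  trans (cong length (primesBelow-suc-prime p))
    (trans (length-++ (primesBelow (suc x))) (+-comm (π x) 1))

π-suc-¬prime : ∀ {x} → ¬ Prime (suc x) → π (suc x) ≡ π x
π-suc-¬prime ¬p = cong length (primesBelow-suc-¬prime ¬p)

π≤π-suc : ∀ x → π x ≤ π (suc x)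
π≤π-suc x with prime? (suc x)
... | yes p = ≤-trans (n≤1+n (π x)) (≤-reflexive (sym (π-suc-prime p)))
... | no ¬p = ≤-reflexive (sym (π-suc-¬prime ¬p))

π-mono : ∀ {x y} → x ≤ y → π x ≤ π y
π-mono {y = zero}  z≤n = ≤-refl
π-mono {y = suc y} x≤1+y with m≤n⇒m<n∨m≡n x≤1+y
... | inj₁ (s≤s x≤y) = ≤-trans (π-mono x≤y) (π≤π-suc y)
... | inj₂ refl      = ≤-refl

primesBetween-suc-prime : ∀ a {x} → Prime x →
  primesBetween a (suc x) ≡ primesBetween a x + length (filter (a <?_) [ x ])
primesBetween-suc-prime a {x} p = begin
  length (filter (a <?_) (primesBelow (suc x)))
    ≡⟨ cong (λ ps → length (filter (a <?_) ps)) (primesBelow-suc-prime p) ⟩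
  length (filter (a <?_) (primesBelow x ++ [ x ]))
    ≡⟨ cong length (filter-++ (a <?_) (primesBelow x) [ x ]) ⟩
  length (filter (a <?_) (primesBelow x) ++ filter (a <?_) [ x ])
    ≡⟨ length-++ (filter (a <?_) (primesBelow x)) ⟩
  primesBetween a x + length (filter (a <?_) [ x ])
    ∎
  where open ≡-Reasoning

primesBetween-suc-¬prime : ∀ a {x} → ¬ Prime x → primesBetween a (suc x) ≡ primesBetween a x
primesBetween-suc-¬prime a ¬p = cong (λ ps → length (filter (a <?_) ps)) (primesBelow-suc-¬prime ¬p)

-- Induction on the upper end: a new prime adds one to both sides exactly when it exceeds `a`. The
-- `suc` turns the excluded upper end into an included one, so that primes in (a, x] are counted.
primesBetween-suc≡π∸π : ∀ a x → primesBetween a (suc x) ≡ π x ∸ π a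
primesBetween-suc≡π∸π a zero = sym (0∸n≡0 (π a))
primesBetween-suc≡π∸π a (suc x) with prime? (suc x) | a <? suc x
... | no ¬p | _ = begin
  primesBetween a (suc (suc x)) ≡⟨ primesBetween-suc-¬prime a ¬p ⟩
  primesBetween a (suc x)       ≡⟨ primesBetween-suc≡π∸π a x ⟩
  π x ∸ π a                     ≡⟨ cong (_∸ π a) (π-suc-¬prime ¬p) ⟨
  π (suc x) ∸ π a               ∎
  where open ≡-Reasoning
... | yes p | yes a<1+x@(s≤s a≤x) = begin
  primesBetween a (suc (suc x))
    ≡⟨ primesBetween-suc-prime a p ⟩
  primesBetween a (suc x) + length (filter (a <?_) [ suc x ])
    ≡⟨ cong₂ _+_ (primesBetween-suc≡π∸π a x) (cong length (filter-accept (a <?_) a<1+x)) ⟩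
  π x ∸ π a + 1
    ≡⟨ +-comm (π x ∸ π a) 1 ⟩
  1 + (π x ∸ π a)
    -- The successor may enter the truncated difference only because `π a ≤ π x`.
    ≡⟨ +-∸-assoc 1 (π-mono a≤x) ⟨
  suc (π x) ∸ π a
    ≡⟨ cong (_∸ π a) (π-suc-prime p) ⟨
  π (suc x) ∸ π a
    ∎
  where open ≡-Reasoning
-- Here `suc x ≤ a`: the new prime is filtered out, and truncation makes both differences 0.
... | yes p | no a≮1+x = begin
  primesBetween a (suc (suc x))
    ≡⟨ primesBetween-suc-prime a p ⟩
  primesBetween a (suc x) + length (filter (a <?_) [ suc x ])
    ≡⟨ cong₂ _+_ (primesBetween-suc≡π∸π a x) (cong length (filter-reject (a <?_) a≮1+x)) ⟩
  π x ∸ π a + 0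
    ≡⟨ +-identityʳ _ ⟩
  π x ∸ π a
    ≡⟨ m≤n⇒m∸n≡0 (π-mono (<⇒≤ 1+x≤a)) ⟩
  0
    ≡⟨ m≤n⇒m∸n≡0 (π-mono 1+x≤a) ⟨
  π (suc x) ∸ π a
    ∎
  where
  open ≡-Reasoning
  1+x≤a = ≮⇒≥ a≮1+x

¬prime[2*n] : ∀ {n} → 2 ≤ n → ¬ Prime (2 * n)
¬prime[2*n] {n} 1<n (prime ¬c) = ¬c (composite {d = 2} (*-monoʳ-< 2 1<n) (m∣m*n n))

-- The excluded endpoint `2 * n` is composite, so including it changes nothing. For n = 1 the
-- endpoint is the prime 2, hence the bound on `n`.
primesBetween-double : ∀ {n} → 2 ≤ n → primesBetween n (2 * n) ≡ π (2 * n) ∸ π (2 * n / 2)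
primesBetween-double {n} 2≤n = begin
  primesBetween n (2 * n)       ≡⟨ primesBetween-suc-¬prime n (¬prime[2*n] 2≤n) ⟨
  primesBetween n (suc (2 * n)) ≡⟨ primesBetween-suc≡π∸π n (2 * n) ⟩
  π (2 * n) ∸ π n               ≡⟨ cong (λ h → π (2 * n) ∸ π h) 2*n/2≡n ⟨
  π (2 * n) ∸ π (2 * n / 2)     ∎
  where
  open ≡-Reasoning
  2*n/2≡n = trans (cong (_/ 2) (*-comm 2 n)) (m*n/n≡m n 2)

even-or-suc-even : ∀ n → (∃[ k ] n ≡ 2 * k) ⊎ (∃[ k ] suc n ≡ 2 * k)
even-or-suc-even zero = inj₁ (0 , refl)
even-or-suc-even (suc n) with even-or-suc-even n
... | inj₁ (k , n≡2k)   = inj₂ (suc k , trans (cong (2 +_) n≡2k) (sym (*-suc 2 k)))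
... | inj₂ (k , 1+n≡2k) = inj₁ (k , 1+n≡2k)

-- If `P r` held, `r` would itself be a positive threshold, smaller than the least one.
least-¬pred : ∀ {P : ℕ → Set} {r} → 0 < r →
  IsLeastPositive (λ k → ∀ x → k ≤ x → P x) (suc r) → ¬ P r
least-¬pred {P} {r} 0<r (_ , above , least) Pr = n≮n r (least r 0<r from-r)
  where
  from-r : ∀ x → r ≤ x → P x
  from-r x r≤x with m≤n⇒m<n∨m≡n r≤x
  ... | inj₁ r<x  = above x r<x
  ... | inj₂ refl = Pr

-- The only prime in (2, 4] is 3, so `π 4 ∸ π (4 / 2)` evaluates to 1, less than `m`. The bound
-- keeps the even prime 2 out of the parity argument and yields `2 ≤ k`.
4<ramanujan : ∀ {m R} → 2 ≤ m → IsRamanujanPrime m R → 4 < R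
4<ramanujan 2≤m (_ , above , _) = ≰⇒> λ R≤4 → n≮n 1 (≤-trans 2≤m (above 4 R≤4))

ramanujan⇒prime : ∀ {m r} → 0 < r → IsRamanujanPrime m (suc r) → Prime (suc r)
ramanujan⇒prime {m} {r} 0<r ram@(_ , above , _) with prime? (suc r)
... | yes p = p
... | no ¬p = contradiction m≤f[r] (least-¬pred 0<r ram)
  where
  open ≤-Reasoning
  m≤f[r] : m ≤ π r ∸ π (r / 2)
  m≤f[r] = begin
    m                         ≤⟨ above (suc r) ≤-refl ⟩
    -- Passing back from a composite `suc r` to `r` keeps the first term, while the subtracted one
    -- can only shrink.
    π (suc r) ∸ π (suc r / 2) ≤⟨ ∸-mono (≤-reflexive (π-suc-¬prime ¬p)) (π-mono (/-monoˡ-≤ 2 (n≤1+n r))) ⟩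
    π r ∸ π (r / 2)           ∎

ramanujan-odd : ∀ {m R} → 2 ≤ m → IsRamanujanPrime m R → ∃[ k ] 2 ≤ k × R ≡ suc (2 * k)
ramanujan-odd {R = zero} 2≤m (() , _)
ramanujan-odd {R = suc r} 2≤m ram with 4<ramanujan 2≤m ram | even-or-suc-even r
... | s≤s 4≤r | inj₁ (k , refl)   = k , *-cancelˡ-≤ 2 4≤r , refl
-- Otherwise `suc r` would be an even prime; as it exceeds 4, its half is at least 2 and it is
-- composite.
... | s≤s 4≤r | inj₂ (k , 1+r≡2k) = contradiction
  (subst Prime 1+r≡2k (ramanujan⇒prime (≤-trans (s≤s z≤n) 4≤r) ram))
  (¬prime[2*n] {k} (*-cancelˡ-≤ 2 (subst (4 ≤_) 1+r≡2k (m≤n⇒m≤1+n 4≤r))))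

proposition2 : ∀ (m R N : ℕ) → 2 ≤ m → IsRamanujanPrime m R → IsN₁ m N → 2 * N ≡ R + 1
proposition2 m R N 2≤m ram@(_ , aboveR , _) (_ , aboveN , leastN) with ramanujan-odd 2≤m ram
... | k , 2≤k , refl = begin
  2 * N           ≡⟨ cong (2 *_) (≤-antisym N≤1+k k<N) ⟩
  2 * suc k       ≡⟨ *-suc 2 k ⟩
  2 + 2 * k       ≡⟨ +-comm 1 (suc (2 * k)) ⟩
  suc (2 * k) + 1 ∎
  where
  open ≡-Reasoning

  1+2k≤2n : ∀ {n} → k < n → suc (2 * k) ≤ 2 * n
  -- The strict inequality `2 * k < 2 * n` unfolds to the required bound.
  1+2k≤2n = *-monoʳ-< 2

  N≤1+k : N ≤ suc k
  N≤1+k = leastN (suc k) (s≤s z≤n) λ n k<n →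
    subst (m ≤_) (sym (primesBetween-double (≤-trans 2≤k (<⇒≤ k<n)))) (aboveR (2 * n) (1+2k≤2n k<n))

  k<N : k < N
  -- If `N ≤ k`, then n = k gives the count at `2 * k`, the predecessor of `R`, a value of at least
  -- `m`, which minimality of `R` forbids.
  k<N = ≰⇒> λ N≤k →
    least-¬pred (≤-trans (s≤s z≤n) (*-monoʳ-≤ 2 2≤k)) ram
      (subst (m ≤_) (primesBetween-double 2≤k) (aboveN k N≤k))
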